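{- Let $k,n$ be integers with $3\le k\le n$ and let $G$ be a connected graph of order $n$. Then $\tau_k(G)=0$ if and only if $G$ satisfies one of the following: (1) $0\le \kappa(G)\le k-2$; (2) $\kappa(G)=\delta(G)=k-1$; (3) $\kappa(G)=k-1$, $\delta(G)\ge k$, and there exists $S\subseteq V(G)$ with $|S|=k$ such that for every $S'\subseteq S$ with $|S'|=k-1$, letting $u_1$ be the vertex of $S\setminus S'$ and $G_i$ the connected component of $G\setminus S'$ containing $u_1$, for every vertex $x\in V(G_i)\setminus S$ and every $(x,S')$-fan, $u_1$ is an internal vertex of some path belonging to this $(x,S')$-fan.
   Context: $\kappa(G)$ is the vertex connectivity and $\delta(G)$ the minimum degree of $G$. Given a vertex $x$ and a vertex set $U$, an $(x,U)$-fan is a set of paths from $x$ to $U$ any two of which share only the vertex $x$; its size is the number of paths. For $S\subseteq V(G)$ with $|S|\ge 2$, a pedant $S$-Steiner tree is a subgraph of $G$ that is a tree containing $S$ in which every vertex of $S$ has degree exactly one. Two pedant $S$-Steiner trees $T,T'$ are internally disjoint if $E(T)\cap E(T')=\emptyset$ and $V(T)\cap V(T')=S$. $\tau_G(S)$ is the maximum number of pairwise internally disjoint pedant $S$-Steiner trees in $G$, and $\tau_k(G)=\min\{\tau_G(S): S\subseteq V(G),\ |S|=k\}$.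
   Formalization: In (3), "every (x,S')-fan" is read as every fan of size k−1 (one path to each vertex of S'); with fans of arbitrary size, (3) would never hold and the equivalence would fail, e.g. for three copies of K_4 joined to {a,b}, {b,c}, {a,c} with k=3. -}

module Defs where

open import Data.Nat using (ℕ; zero; suc; _≤_; _∸_)
open import Data.Fin using (Fin)
open import Data.Fin.Subset using (Subset; _∈_; _∉_; _⊆_; ∣_∣; ∁)
open import Data.List using (List; head; last; length)
open import Data.List.Relation.Unary.Linked using (Linked)
open import Data.List.Relation.Unary.Unique.Propositional using (Unique)
import Data.List.Membership.Propositional as LM
open import Data.Maybe using (just)
open import Data.Product using (Σ; ∃; ∃-syntax; _×_)
open import Data.Sum using (_⊎_)
open import Relation.Binary.PropositionalEquality using (_≡_; _≢_)
open import Relation.Nullary using (¬_)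

record Graph (n : ℕ) : Set where
  field
    adj   : Fin n → Subset n
    sym   : ∀ {u v} → v ∈ adj u → u ∈ adj v
    irrefl : ∀ {v} → v ∉ adj v
open Graph public

module _ {n : ℕ} where

  Rel : Set₁
  Rel = Fin n → Fin n → Set

  IsPath : Rel → Fin n → Fin n → List (Fin n) → Set
  IsPath R u v xs = Linked R xs × Unique xs × head xs ≡ just u × last xs ≡ just v

  Adj : Graph n → Rel
  Adj G u v = v ∈ adj G u

  AdjMinus : Graph n → Subset n → Rel
  AdjMinus G X u v = u ∉ X × v ∉ X × v ∈ adj G u

  Connected : Graph n → Set
  Connected G = ∀ u v → ∃[ xs ] IsPath (Adj G) u v xs

  DisconnectedMinus : Graph n → Subset n → Set
  DisconnectedMinus G X =
    ∃[ u ] ∃[ v ] (u ∉ X × v ∉ X × ¬ (∃[ xs ] IsPath (AdjMinus G X) u v xs))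

  Separating : Graph n → Subset n → Set
  Separating G X = DisconnectedMinus G X ⊎ ∣ ∁ X ∣ ≤ 1

  IsConnectivity : Graph n → ℕ → Set
  IsConnectivity G c =
    (∃[ X ] (∣ X ∣ ≡ c × Separating G X)) × (∀ X → Separating G X → c ≤ ∣ X ∣)

  degree : Graph n → Fin n → ℕ
  degree G v = ∣ adj G v ∣

  IsMinDegree : Graph n → ℕ → Set
  IsMinDegree G d = (∃[ v ] degree G v ≡ d) × (∀ v → d ≤ degree G v)

  record Subgraph (G : Graph n) : Set where
    field
      V    : Subset n
      E    : Fin n → Subset n
      E⊆G  : ∀ u → E u ⊆ adj G u
      Esym : ∀ {u v} → v ∈ E u → u ∈ E v
      E⊆V  : ∀ {u v} → v ∈ E u → u ∈ V
  open Subgraph public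

  module _ {G : Graph n} where

    AdjT : Subgraph G → Rel
    AdjT T u v = v ∈ E T u

    TConnected : Subgraph G → Set
    TConnected T = ∀ u v → u ∈ V T → v ∈ V T → ∃[ xs ] IsPath (AdjT T) u v xs

    HasCycle : Subgraph G → Set
    HasCycle T = ∃[ xs ] ∃[ u ] ∃[ v ]
      (3 ≤ length xs × Linked (AdjT T) xs × Unique xs ×
       head xs ≡ just u × last xs ≡ just v × AdjT T v u)

    IsTree : Subgraph G → Set
    IsTree T = TConnected T × ¬ HasCycle T

    IsPedantSteinerTree : Subset n → Subgraph G → Set
    IsPedantSteinerTree S T =
      IsTree T × S ⊆ V T × (∀ s → s ∈ S → ∣ E T s ∣ ≡ 1)

    InternallyDisjoint : Subset n → Subgraph G → Subgraph G → Set
    InternallyDisjoint S T T' =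
      (∀ u v → v ∈ E T u → v ∉ E T' u) ×
      (∀ v → v ∈ V T → v ∈ V T' → v ∈ S)

  HasTrees : (G : Graph n) → Subset n → ℕ → Set
  HasTrees G S t = Σ (Fin t → Subgraph G) λ F →
    (∀ i → IsPedantSteinerTree S (F i)) ×
    (∀ i j → i ≢ j → InternallyDisjoint S (F i) (F j))

  IsTauS : Graph n → Subset n → ℕ → Set
  IsTauS G S t = HasTrees G S t × ¬ HasTrees G S (suc t)

  IsTauK : Graph n → ℕ → ℕ → Set
  IsTauK G k t =
    (∃[ S ] (∣ S ∣ ≡ k × IsTauS G S t)) ×
    (∀ S → ∣ S ∣ ≡ k → HasTrees G S t)

  IsXUPath : Graph n → Fin n → Subset n → List (Fin n) → Set
  IsXUPath G x U xs = ∃[ y ] (y ∈ U × IsPath (Adj G) x y xs ×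
    (∀ z → z LM.∈ xs → z ∈ U → z ≡ y))

  IsFan : Graph n → Fin n → Subset n → (m : ℕ) → (Fin m → List (Fin n)) → Set
  IsFan G x U m P = (∀ i → IsXUPath G x U (P i)) ×
    (∀ i j → i ≢ j → ∀ z → z LM.∈ P i → z LM.∈ P j → z ≡ x)

  Internal : Fin n → List (Fin n) → Set
  Internal v xs = v LM.∈ xs × head xs ≢ just v × last xs ≢ just v

  FanCondition : Graph n → ℕ → Set
  FanCondition G k = ∃[ S ] (∣ S ∣ ≡ k ×
    (∀ S' → S' ⊆ S → ∣ S' ∣ ≡ k ∸ 1 →
      ∀ u₁ → u₁ ∈ S → u₁ ∉ S' →
      ∀ x → ∃[ ys ] IsPath (AdjMinus G S') u₁ x ys →   -- x ∈ V(G_i)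
            x ∉ S →
      ∀ (P : Fin (k ∸ 1) → List (Fin n)) → IsFan G x S' (k ∸ 1) P →
      ∃[ i ] Internal u₁ (P i)))

{-# OPTIONS --safe #-}
-- For k ≥ 3 no edge of a pedant S-Steiner tree joins two terminals, so such a tree exists iff some
-- component of G − S is adjacent to every vertex of S, and τ_k(G) = 0 iff some k-set S admits no such
-- component.  A separator X with two vertices it separates, or a vertex of degree k − 1 with its
-- neighbours, is contained in a bad S.  If κ ≥ k every component works, as its neighbourhood is a
-- subset of S and, if proper, separates.  If κ = k − 1 and a good component exists, Menger's theorem
-- gives a fan of size k − 1 from a vertex x of it to S; the fan misses exactly one u₁ ∈ S, which
-- contradicts (3).  Conversely a fan from x to S ∖ {u₁} avoiding u₁, together with a path from u₁ to x,
-- exhibits a good component.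
module Submission where

open import Defs
open import Data.Nat using (ℕ; zero; suc; _+_; _≤_; _<_; _∸_; z≤n; s≤s)
import Data.Nat.Properties as ℕ
open import Data.Fin using (Fin; zero; suc; _≟_)
open import Data.Fin.Properties using (any?; suc-injective)
open import Data.Fin.Subset using (Subset; _∈_; _∉_; _⊆_; ∣_∣; ∁; _∪_; _∩_; _-_; ⁅_⁆; ⊤; ⊥; inside; outside)
open import Data.Fin.Subset.Properties
open import Data.List using (List; []; _∷_; head; last; length; filter; cartesianProduct; allFin)
import Data.List.Membership.Propositional as LM
open import Data.List.Membership.Propositional.Properties using (∈-filter⁺; ∈-filter⁻; ∈-cartesianProduct⁺; ∈-allFin)
open import Data.List.Relation.Unary.All using (All; []; _∷_)
import Data.List.Relation.Unary.All as All
open import Data.List.Relation.Unary.All.Properties using (¬Any⇒All¬)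
open import Data.List.Relation.Unary.AllPairs using ([]; _∷_)
open import Data.List.Relation.Unary.Any using (here; there)
import Data.List.Relation.Unary.Any as Any
open import Data.List.Relation.Unary.Linked using (Linked; []; [-]; _∷_)
import Data.List.Relation.Unary.Linked as Linked
open import Data.List.Relation.Unary.Unique.Propositional using (Unique)
open import Data.Maybe using (just)
open import Data.Maybe.Properties using (just-injective)
open import Data.Product using (Σ; ∃-syntax; ∃₂; _×_; _,_; proj₁; proj₂)
open import Data.Sum using (_⊎_; inj₁; inj₂; [_,_]′)
import Data.Sum as Sum
open import Data.Unit using (tt) renaming (⊤ to Unit)
import Data.Vec as Vec
open import Data.Vec using (_∷_)
open import Data.Vec.Properties using (lookup∘tabulate; lookup⇒[]=; []=⇒lookup)
open import Function using (_∘_; id)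
open import Function.Bundles using (_⇔_; mk⇔)
open import Relation.Binary.Definitions using (tri<; tri≈; tri>)
open import Relation.Binary.PropositionalEquality using (_≡_; _≢_; refl; trans; cong; subst) renaming (sym to ≡-sym)
open import Relation.Nullary using (¬_; Dec; yes; no; contradiction; does)
open import Relation.Nullary.Decidable using (_×-dec_; _⊎-dec_; ¬?; toSum; dec-true)

private
  variable
    n m : ℕ

-- Counting in finite subsets

-- Deleting `x` twice is the same as deleting it once, whereas deleting a member lowers the size.
x∉p-x : (p : Subset n) (x : Fin n) → x ∉ p - x
x∉p-x p x x∈ = ℕ.<-irrefl (cong ∣_∣ (p─q─q≡p─q p ⁅ x ⁆)) (x∈p⇒∣p-x∣<∣p∣ x∈)

y∈p-x⇒y≢x : {p : Subset n} {x y : Fin n} → y ∈ p - x → y ≢ x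
y∈p-x⇒y≢x {p = p} {x} h refl = x∉p-x p x h

p-x⊆p : (p : Subset n) (x : Fin n) → p - x ⊆ p
p-x⊆p p x = p─q⊆p p ⁅ x ⁆

x∈p∪⁅x⁆ : (p : Subset n) (x : Fin n) → x ∈ p ∪ ⁅ x ⁆
x∈p∪⁅x⁆ p x = q⊆p∪q p ⁅ x ⁆ (x∈⁅x⁆ x)

y∈p∪⁅x⁆⁻ : (p : Subset n) {x y : Fin n} → y ∈ p ∪ ⁅ x ⁆ → y ∈ p ⊎ y ≡ x
y∈p∪⁅x⁆⁻ p {x} h = Sum.map₂ (x∈⁅y⁆⇒x≡y x) (x∈p∪q⁻ p ⁅ x ⁆ h)

∣p∪⁅x⁆∣≤1+∣p∣ : (p : Subset n) (x : Fin n) → ∣ p ∪ ⁅ x ⁆ ∣ ≤ suc ∣ p ∣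
∣p∪⁅x⁆∣≤1+∣p∣ (outside ∷ p) zero rewrite ∪-identityʳ p = ℕ.≤-refl
∣p∪⁅x⁆∣≤1+∣p∣ (inside ∷ p) zero rewrite ∪-identityʳ p = ℕ.n≤1+n _
∣p∪⁅x⁆∣≤1+∣p∣ (outside ∷ p) (suc x) = ∣p∪⁅x⁆∣≤1+∣p∣ p x
∣p∪⁅x⁆∣≤1+∣p∣ (inside ∷ p) (suc x) = s≤s (∣p∪⁅x⁆∣≤1+∣p∣ p x)

∣p∣≤1+∣p-x∣ : (p : Subset n) (x : Fin n) → ∣ p ∣ ≤ suc ∣ p - x ∣
∣p∣≤1+∣p-x∣ p x = ℕ.≤-trans (p⊆q⇒∣p∣≤∣q∣ split) (∣p∪⁅x⁆∣≤1+∣p∣ (p - x) x)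
  where
  split : p ⊆ (p - x) ∪ ⁅ x ⁆
  split {y} y∈p with y ≟ x
  ... | yes refl = x∈p∪⁅x⁆ (p - x) x
  ... | no y≢x = p⊆p∪q ⁅ x ⁆ (x∈p∧x≢y⇒x∈p-y y∈p y≢x)

x∈p⇒1+∣p-x∣≡∣p∣ : {p : Subset n} {x : Fin n} → x ∈ p → suc ∣ p - x ∣ ≡ ∣ p ∣
x∈p⇒1+∣p-x∣≡∣p∣ {p = p} {x} x∈p = ℕ.≤-antisym (x∈p⇒∣p-x∣<∣p∣ x∈p) (∣p∣≤1+∣p-x∣ p x)

x∉p⇒∣p∪⁅x⁆∣≡1+∣p∣ : {p : Subset n} {x : Fin n} → x ∉ p → ∣ p ∪ ⁅ x ⁆ ∣ ≡ suc ∣ p ∣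
x∉p⇒∣p∪⁅x⁆∣≡1+∣p∣ {p = p} {x} x∉p =
  ℕ.≤-antisym (∣p∪⁅x⁆∣≤1+∣p∣ p x) (p⊂q⇒∣p∣<∣q∣ (p⊆p∪q ⁅ x ⁆ , x , x∈p∪⁅x⁆ p x , x∉p))

∃∉ : (p : Subset n) → ∣ p ∣ < n → ∃[ x ] x ∉ p
∃∉ {n} p ∣p∣<n with any? (λ x → ¬? (x ∈? p))
... | yes h = h
... | no ¬h = contradiction ∣p∣<n (ℕ.≤⇒≯ (ℕ.≤-trans (ℕ.≤-reflexive (≡-sym (∣⊤∣≡n n))) (p⊆q⇒∣p∣≤∣q∣ full)))
  where
  full : ⊤ ⊆ p
  full {x} _ with x ∈? p
  ... | yes x∈p = x∈p
  ... | no x∉p = contradiction (x , x∉p) ¬h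

∃∈∖ : (p q : Subset n) → ∣ q ∣ < ∣ p ∣ → ∃[ x ] (x ∈ p × x ∉ q)
∃∈∖ p q ∣q∣<∣p∣ with any? (λ x → (x ∈? p) ×-dec ¬? (x ∈? q))
... | yes h = h
... | no ¬h = contradiction ∣q∣<∣p∣ (ℕ.≤⇒≯ (p⊆q⇒∣p∣≤∣q∣ incl))
  where
  incl : p ⊆ q
  incl {x} x∈p with x ∈? q
  ... | yes x∈q = x∈q
  ... | no x∉q = contradiction (x , x∈p , x∉q) ¬h

∣p∣>0⇒∃∈ : (p : Subset n) → 0 < ∣ p ∣ → ∃[ x ] x ∈ p
∣p∣>0⇒∃∈ {n} p ∣p∣>0 with ∃∈∖ p ⊥ (subst (_< ∣ p ∣) (≡-sym (∣⊥∣≡0 n)) ∣p∣>0)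
... | x , x∈p , _ = x , x∈p

∃⊇-of-size : (k : ℕ) (p : Subset n) → ∣ p ∣ ≤ k → k ≤ n → ∃[ q ] (p ⊆ q × ∣ q ∣ ≡ k)
∃⊇-of-size {n} k p ∣p∣≤k k≤n = go (k ∸ ∣ p ∣) p (ℕ.m+[n∸m]≡n ∣p∣≤k)
  where
  go : ∀ f (p : Subset n) → ∣ p ∣ + f ≡ k → ∃[ q ] (p ⊆ q × ∣ q ∣ ≡ k)
  go zero p eq = p , id , trans (≡-sym (ℕ.+-identityʳ _)) eq
  go (suc f) p eq =
    let x , x∉p = ∃∉ p (ℕ.<-≤-trans (ℕ.m<m+n ∣ p ∣ (s≤s z≤n)) (ℕ.≤-trans (ℕ.≤-reflexive eq) k≤n))
        q , p∪x⊆q , ∣q∣ = go f (p ∪ ⁅ x ⁆)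
          (trans (cong (_+ f) (x∉p⇒∣p∪⁅x⁆∣≡1+∣p∣ x∉p)) (trans (≡-sym (ℕ.+-suc ∣ p ∣ f)) eq))
    in q , p∪x⊆q ∘ p⊆p∪q ⁅ x ⁆ , ∣q∣

covering⇒∣p∣≤m : (p : Subset n) (f : Fin m → Fin n) → (∀ {x} → x ∈ p → ∃[ i ] f i ≡ x) → ∣ p ∣ ≤ m
covering⇒∣p∣≤m {n} {zero} p f cov =
  ℕ.≤-reflexive (trans (cong ∣_∣ (Empty-unique {p = p} λ { (x , x∈p) → contradiction (proj₁ (cov x∈p)) λ () })) (∣⊥∣≡0 n))
covering⇒∣p∣≤m {m = suc m} p f cov =
  ℕ.≤-trans (∣p∣≤1+∣p-x∣ p (f zero)) (s≤s (covering⇒∣p∣≤m (p - f zero) (f ∘ suc) cov′))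
  where
  cov′ : ∀ {x} → x ∈ p - f zero → ∃[ i ] f (suc i) ≡ x
  cov′ h with cov (p-x⊆p p (f zero) h)
  ... | zero , eq = contradiction (≡-sym eq) (y∈p-x⇒y≢x h)
  ... | suc i , eq = i , eq

injective⇒m≤∣p∣ : (p : Subset n) (f : Fin m → Fin n) → (∀ i → f i ∈ p) →
  (∀ i j → f i ≡ f j → i ≡ j) → m ≤ ∣ p ∣
injective⇒m≤∣p∣ {m = zero} p f into inj = z≤n
injective⇒m≤∣p∣ {m = suc m} p f into inj =
  ℕ.≤-trans (s≤s (injective⇒m≤∣p∣ (p - f zero) (f ∘ suc)
    (λ i → x∈p∧x≢y⇒x∈p-y (into (suc i)) (λ eq → contradiction (inj _ _ eq) λ ()))
    (λ i j eq → suc-injective (inj _ _ eq))))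
    (x∈p⇒∣p-x∣<∣p∣ (into zero))

-- A missed element could be removed from `p`, leaving fewer than `m` places for `m` distinct
-- values.
injective⇒covering : (p : Subset n) (f : Fin m → Fin n) → (∀ i → f i ∈ p) →
  (∀ i j → f i ≡ f j → i ≡ j) → ∣ p ∣ ≤ m → ∀ {x} → x ∈ p → ∃[ i ] f i ≡ x
injective⇒covering p f into inj ∣p∣≤m {x} x∈p with any? (λ i → f i ≟ x)
... | yes h = h
... | no ¬h = contradiction
  (injective⇒m≤∣p∣ (p - x) f (λ i → x∈p∧x≢y⇒x∈p-y (into i) (λ eq → ¬h (i , eq))) inj)
  (ℕ.<⇒≱ (ℕ.<-≤-trans (x∈p⇒∣p-x∣<∣p∣ x∈p) ∣p∣≤m))

∣p∣≡1⇒≡ : {p : Subset n} {x y : Fin n} → ∣ p ∣ ≡ 1 → x ∈ p → y ∈ p → x ≡ y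
∣p∣≡1⇒≡ {p = p} {x} eq x∈p y∈p =
  proj₂ (injective⇒covering p (λ (_ : Fin 1) → x) (λ _ → x∈p) (λ { zero zero _ → refl }) (ℕ.≤-reflexive eq) y∈p)

-- Walks

-- Unlike in `IsPath`, vertices may repeat, so walks concatenate freely. The predicate `P` holds at
-- every vertex, both ends included, and records what the walk avoids or where it stays.
data Walk {V : Set} (R : V → V → Set) (P : V → Set) : V → V → Set where
  [_] : ∀ {u} → P u → Walk R P u u
  _∷⟨_⟩_ : ∀ {u v w} → P u → R u v → Walk R P v w → Walk R P u w

infixr 5 _∷⟨_⟩_

module _ {V : Set} {R : V → V → Set} where

  mapʷ : ∀ {R′ P P′ u v} → (∀ {a b} → R a b → R′ a b) → (∀ {a} → P a → P′ a) →
    Walk R P u v → Walk R′ P′ u v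
  mapʷ f g [ p ] = [ g p ]
  mapʷ f g (p ∷⟨ r ⟩ w) = g p ∷⟨ f r ⟩ mapʷ f g w

  _++⟨_⟩_ : ∀ {P u v v′ w} → Walk R P u v → R v v′ → Walk R P v′ w → Walk R P u w
  [ p ] ++⟨ r ⟩ w₂ = p ∷⟨ r ⟩ w₂
  (p ∷⟨ r′ ⟩ w₁) ++⟨ r ⟩ w₂ = p ∷⟨ r′ ⟩ (w₁ ++⟨ r ⟩ w₂)

  _++ʷ_ : ∀ {P u v w} → Walk R P u v → Walk R P v w → Walk R P u w
  [ p ] ++ʷ w₂ = w₂
  (p ∷⟨ r ⟩ w₁) ++ʷ w₂ = p ∷⟨ r ⟩ (w₁ ++ʷ w₂)

  headʷ : ∀ {P u v} → Walk R P u v → P u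
  headʷ [ p ] = p
  headʷ (p ∷⟨ _ ⟩ _) = p

  lastʷ : ∀ {P u v} → Walk R P u v → P v
  lastʷ [ p ] = p
  lastʷ (_ ∷⟨ _ ⟩ w) = lastʷ w

  annotateEdges : ∀ {P u v} → Walk R P u v → Walk (λ a b → P a × P b × R a b) P u v
  annotateEdges [ p ] = [ p ]
  annotateEdges (p ∷⟨ r ⟩ w) = p ∷⟨ p , headʷ w , r ⟩ annotateEdges w

  fromLinked : ∀ {P u v} xs → Linked R (u ∷ xs) → last (u ∷ xs) ≡ just v → All P (u ∷ xs) → Walk R P u v
  fromLinked [] l refl (p ∷ []) = [ p ]
  fromLinked (y ∷ xs) (r ∷ l) eq (p ∷ ps) = p ∷⟨ r ⟩ fromLinked xs l eq ps

last-∈ : ∀ {v : Fin n} xs → last xs ≡ just v → v LM.∈ xs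
last-∈ (x ∷ []) refl = here refl
last-∈ (x ∷ y ∷ xs) eq = there (last-∈ (y ∷ xs) eq)

head-∈ : ∀ {v : Fin n} xs → head xs ≡ just v → v LM.∈ xs
head-∈ (x ∷ xs) refl = here refl

module _ {R : Fin n → Fin n → Set} where

  shortcut : ∀ {v w} {P : Fin n → Set} xs → IsPath R w v xs → All P xs → ∀ {u} → u LM.∈ xs →
    ∃[ ys ] (IsPath R u v ys × All P ys)
  shortcut (x ∷ xs) (l , d , h , e) ps (here refl) = x ∷ xs , (l , d , refl , e) , ps
  shortcut (x ∷ y ∷ xs) (l , (_ ∷ d) , h , e) (_ ∷ ps) (there u∈) =
    shortcut (y ∷ xs) (Linked.tail l , d , refl , e) ps u∈

  -- Loop erasure: if the new first vertex already lies on the path built so far, that path is cut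
  -- down to its part from this vertex on.
  toPath : ∀ {P u v} → Walk R P u v → ∃[ xs ] (IsPath R u v xs × All P xs)
  toPath {u = u} [ p ] = u ∷ [] , ([-] , [] ∷ [] , refl , refl) , p ∷ []
  toPath {u = u} (p ∷⟨ r ⟩ w) with toPath w
  ... | y ∷ ys , (l , d , refl , e) , ps with Any.any? (u ≟_) (y ∷ ys)
  ...   | yes u∈ = shortcut (y ∷ ys) (l , d , refl , e) ps u∈
  ...   | no u∉ = u ∷ y ∷ ys , (r ∷ l , ¬Any⇒All¬ _ u∉ ∷ d , refl , e) , p ∷ ps

  fromPath : ∀ {P u v xs} → IsPath R u v xs → All P xs → Walk R P u v
  fromPath {xs = x ∷ xs} (l , _ , refl , e) = fromLinked xs l e

  TwoNeighbours : Fin n → Set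
  TwoNeighbours z = ∃₂ λ a b → a ≢ b × R a z × R z b

  -- A vertex of degree one can therefore only be an end of a path; in a cycle the closing edge
  -- supplies the second neighbour at both ends.
  end-or-interior : ∀ {z} xs → Linked R xs → Unique xs → z LM.∈ xs →
    head xs ≡ just z ⊎ last xs ≡ just z ⊎ TwoNeighbours z
  end-or-interior (x ∷ xs) l d (here refl) = inj₁ refl
  end-or-interior (x ∷ y ∷ xs) (r ∷ l) (x# ∷ d) (there z∈) with end-or-interior (y ∷ xs) l d z∈
  ... | inj₂ h = inj₂ h
  end-or-interior (x ∷ y ∷ []) (r ∷ l) (x# ∷ d) (there z∈) | inj₁ refl = inj₂ (inj₁ refl)
  end-or-interior (x ∷ y ∷ w ∷ xs) (r ∷ r′ ∷ l) ((_ ∷ x≢w ∷ _) ∷ d) (there z∈) | inj₁ refl =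
    inj₂ (inj₂ (x , w , x≢w , r , r′))

  penultimate : ∀ {v} x y xs → Linked R (x ∷ y ∷ xs) → last (y ∷ xs) ≡ just v →
    ∃[ a ] (a LM.∈ (x ∷ y ∷ xs) × R a v)
  penultimate x y [] (r ∷ _) refl = x , here refl , r
  penultimate x y (z ∷ xs) (_ ∷ l) eq = let a , a∈ , r = penultimate y z xs l eq in a , there a∈ , r

  on-cycle : ∀ {u v z} xs → 3 ≤ length xs → Linked R xs → Unique xs → head xs ≡ just u →
    last xs ≡ just v → R v u → z LM.∈ xs → TwoNeighbours z
  on-cycle (x ∷ []) (s≤s ()) _ _ _ _ _ _
  on-cycle (x ∷ y ∷ []) (s≤s (s≤s ())) _ _ _ _ _ _
  on-cycle {u} {v} (x ∷ y ∷ w ∷ xs) _ l@(r ∷ r′ ∷ l′) d@(x# ∷ y# ∷ _) refl e vu z∈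
    with end-or-interior (x ∷ y ∷ w ∷ xs) l d z∈
  -- The first vertex lies between the last and the second, the last one between the penultimate and
  -- the first; having at least three vertices keeps these apart.
  ... | inj₁ refl = v , y , (λ { refl → All.lookup y# (last-∈ (w ∷ xs) e) refl }) , vu , r
  ... | inj₂ (inj₂ h) = h
  ... | inj₂ (inj₁ e′) with trans (≡-sym e) e′
  ...   | refl = let a , a∈ , rav = penultimate y w xs (r′ ∷ l′) e
                 in a , x , (λ { refl → All.lookup x# a∈ refl }) , rav , vu

-- Menger's theorem

choose : (k : ℕ) (p : Subset n) → k ≤ ∣ p ∣ →
  Σ (Fin k → Fin n) λ f → (∀ i → f i ∈ p) × (∀ i j → f i ≡ f j → i ≡ j)
choose zero p _ = (λ ()) , (λ ()) , λ ()
choose {n} (suc k) p k<∣p∣ with ∣p∣>0⇒∃∈ p (ℕ.≤-<-trans z≤n k<∣p∣)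
... | x , x∈p with choose k (p - x) (ℕ.≤-pred (ℕ.≤-trans k<∣p∣ (∣p∣≤1+∣p-x∣ p x)))
...   | f , into , inj = g , into′ , inj′
  where
  g : Fin (suc k) → Fin n
  g zero = x
  g (suc i) = f i
  into′ : ∀ i → g i ∈ p
  into′ zero = x∈p
  into′ (suc i) = p-x⊆p p x (into i)
  inj′ : ∀ i j → g i ≡ g j → i ≡ j
  inj′ zero zero _ = refl
  inj′ zero (suc j) eq = contradiction (≡-sym eq) (y∈p-x⇒y≢x (into j))
  inj′ (suc i) zero eq = contradiction eq (y∈p-x⇒y≢x (into i))
  inj′ (suc i) (suc j) eq = cong suc (inj i j eq)

module _ (R : Fin n → Fin n → Set) where

  -- The walks may repeat vertices: only the disjointness of the regions U i matters.
  record Linkage (A B : Subset n) (k : ℕ) : Set₁ where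
    field
      U        : Fin k → Fin n → Set
      disjoint : ∀ i j {z} → U i z → U j z → i ≡ j
      src tgt  : Fin k → Fin n
      src∈     : ∀ i → src i ∈ A
      tgt∈     : ∀ i → tgt i ∈ B
      walk     : ∀ i → Walk R (U i) (src i) (tgt i)

  -- The ends of a walk count too: `X` may contain vertices of `A` and `B`, and must contain all
  -- that they share.
  Separates : Subset n → Subset n → Subset n → Set
  Separates A B X = ∀ {a b} → a ∈ A → b ∈ B → ¬ Walk R (_∉ X) a b

  -- Invariant of a walk from `a` cut at its first vertex `p` in `Y`. The last component keeps the
  -- initial segment up to `z`, to be spliced later with a final segment into a walk avoiding `X`.
  UntilHit : (X Y : Subset n) (P : Fin n → Set) (a p z : Fin n) → Set
  UntilHit X Y P a p z = P z × (z ≡ p ⊎ z ∉ Y) × (z ∉ X → Walk R (_∉ X) a z)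

  SinceHit : (X Y : Subset n) (P : Fin n → Set) (b q z : Fin n) → Set
  SinceHit X Y P b q z = P z × (z ≡ q ⊎ z ∉ Y) × (z ∉ X → Walk R (_∉ X) z b)

module _ {R : Fin n → Fin n → Set} {X Y : Subset n} (X⊆Y : X ⊆ Y) {P : Fin n → Set} where

  untilHit : ∀ {a b} → Walk R P a b → b ∈ Y → ∃[ p ] (p ∈ Y × Walk R (UntilHit R X Y P a p) a p)
  untilHit {a} [ Pa ] a∈Y = a , a∈Y , [ Pa , inj₁ refl , [_] ]
  untilHit {a} (Pa ∷⟨ r ⟩ w) b∈Y with a ∈? Y
  ... | yes a∈Y = a , a∈Y , [ Pa , inj₁ refl , [_] ]
  ... | no a∉Y with untilHit w b∈Y
  ...   | p , p∈Y , w′ = p , p∈Y , (Pa , inj₂ a∉Y , [_]) ∷⟨ r ⟩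
          mapʷ id (λ (Pz , h , back) → Pz , h , λ z∉X → (a∉Y ∘ X⊆Y) ∷⟨ r ⟩ back z∉X) w′

  -- The mirror image, cut at the last visit to `Y`. The first alternative, a walk that never meets
  -- `Y`, is what the recursion may find on a tail.
  sinceHit : ∀ {a b} → Walk R P a b →
    Walk R (λ z → P z × z ∉ Y × Walk R (_∉ X) z b) a b ⊎
    ∃[ q ] (q ∈ Y × Walk R (SinceHit R X Y P b q) q b)
  sinceHit {a} [ Pa ] with a ∈? Y
  ... | yes a∈Y = inj₂ (a , a∈Y , [ Pa , inj₁ refl , [_] ])
  ... | no a∉Y = inj₁ [ Pa , a∉Y , [ a∉Y ∘ X⊆Y ] ]
  sinceHit {a} (Pa ∷⟨ r ⟩ w) with sinceHit w | a ∈? Y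
  ... | inj₂ h | _ = inj₂ h
  ... | inj₁ w′ | yes a∈Y = inj₂ (a , a∈Y ,
          (Pa , inj₁ refl , λ a∉X → a∉X ∷⟨ r ⟩ proj₂ (proj₂ (headʷ w′))) ∷⟨ r ⟩
          mapʷ id (λ (Pz , z∉Y , on) → Pz , inj₂ z∉Y , λ _ → on) w′)
  ... | inj₁ w′ | no a∉Y =
          inj₁ ((Pa , a∉Y , (a∉Y ∘ X⊆Y) ∷⟨ r ⟩ proj₂ (proj₂ (headʷ w′))) ∷⟨ r ⟩ w′)

avoids-or-meets : ∀ {R : Fin n → Fin n → Set} {P a b} (X : Subset n) → Walk R P a b →
  Walk R (_∉ X) a b ⊎ ∃[ t ] (t ∈ X × Walk R P a t × Walk R P t b)
avoids-or-meets {a = a} X [ p ] with a ∈? X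
... | yes a∈X = inj₂ (a , a∈X , [ p ] , [ p ])
... | no a∉X = inj₁ [ a∉X ]
avoids-or-meets {a = a} X (p ∷⟨ r ⟩ w) with a ∈? X | avoids-or-meets X w
... | yes a∈X | _ = inj₂ (a , a∈X , [ p ] , p ∷⟨ r ⟩ w)
... | no a∉X | inj₁ w′ = inj₁ (a∉X ∷⟨ r ⟩ w′)
... | no a∉X | inj₂ (t , t∈X , w₁ , w₂) = inj₂ (t , t∈X , p ∷⟨ r ⟩ w₁ , w₂)

Edge : List (Fin n × Fin n) → Fin n → Fin n → Set
Edge E u v = (u , v) LM.∈ E

-- The two walks are what precedes the first use of the new edge and what follows its last use;
-- everything between is dropped.
split-at-edge : ∀ {E x y a b} {P : Fin n → Set} → Walk (Edge ((x , y) ∷ E)) P a b →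
  Walk (Edge E) P a b ⊎ (Walk (Edge E) P a x × Walk (Edge E) P y b)
split-at-edge [ p ] = inj₁ [ p ]
split-at-edge (p ∷⟨ here refl ⟩ w) with split-at-edge w
... | inj₁ w′ = inj₂ ([ p ] , w′)
... | inj₂ (_ , w′) = inj₂ ([ p ] , w′)
split-at-edge (p ∷⟨ there r ⟩ w) with split-at-edge w
... | inj₁ w′ = inj₁ (p ∷⟨ r ⟩ w′)
... | inj₂ (w₁ , w₂) = inj₂ (p ∷⟨ r ⟩ w₁ , w₂)

module _ {E : List (Fin n × Fin n)} {x y : Fin n} {A B X : Subset n} {k : ℕ}
         (∣X∣<k : ∣ X ∣ < k) (X-sep : Separates (Edge E) A B X) where

  -- A walk from `A` to `B` contains an initial walk over the old edges to `X ∪ ⁅ x ⁆`: it reaches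
  -- `x` if it uses the new edge, and otherwise meets `X`, which separates.
  separates-front : ∀ {Z} → Separates (Edge E) A (X ∪ ⁅ x ⁆) Z → Separates (Edge ((x , y) ∷ E)) A B Z
  separates-front Z-sep a∈A b∈B w with split-at-edge w
  ... | inj₂ (w₁ , _) = Z-sep a∈A (x∈p∪⁅x⁆ X x) w₁
  ... | inj₁ w′ with avoids-or-meets X w′
  ...   | inj₁ w″ = X-sep a∈A b∈B w″
  ...   | inj₂ (t , t∈X , w₁ , _) = Z-sep a∈A (p⊆p∪q ⁅ x ⁆ t∈X) w₁

  separates-back : ∀ {Z} → Separates (Edge E) (X ∪ ⁅ y ⁆) B Z → Separates (Edge ((x , y) ∷ E)) A B Z
  separates-back Z-sep a∈A b∈B w with split-at-edge w
  ... | inj₂ (_ , w₂) = Z-sep (x∈p∪⁅x⁆ X y) b∈B w₂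
  ... | inj₁ w′ with avoids-or-meets X w′
  ...   | inj₁ w″ = X-sep a∈A b∈B w″
  ...   | inj₂ (t , t∈X , _ , w₂) = Z-sep (p⊆p∪q ⁅ y ⁆ t∈X) b∈B w₂

  module _ (P : Linkage (Edge E) A (X ∪ ⁅ x ⁆) k) (Q : Linkage (Edge E) (X ∪ ⁅ y ⁆) B k) where
    private
      module P = Linkage P
      module Q = Linkage Q

      ⊆∪ : ∀ {v} → X ⊆ X ∪ ⁅ v ⁆
      ⊆∪ {v} = p⊆p∪q ⁅ v ⁆

      hitP : ∀ i → _
      hitP i = untilHit {X = X} ⊆∪ (P.walk i) (P.tgt∈ i)

      p : Fin k → Fin n
      p i = proj₁ (hitP i)

      UP : Fin k → Fin n → Set
      UP i = UntilHit (Edge E) X (X ∪ ⁅ x ⁆) (P.U i) (P.src i) (p i)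

      p∈ : ∀ i → p i ∈ X ∪ ⁅ x ⁆
      p∈ i = proj₁ (proj₂ (hitP i))

      walkP : ∀ i → Walk (Edge E) (UP i) (P.src i) (p i)
      walkP i = proj₂ (proj₂ (hitP i))

      hitQ : ∀ j → ∃[ q ] (q ∈ X ∪ ⁅ y ⁆ ×
        Walk (Edge E) (SinceHit (Edge E) X (X ∪ ⁅ y ⁆) (Q.U j) (Q.tgt j) q) q (Q.tgt j))
      hitQ j with sinceHit {X = X} ⊆∪ (Q.walk j)
      ... | inj₁ w = contradiction (Q.src∈ j) (proj₁ (proj₂ (headʷ w)))
      ... | inj₂ h = h

      q : Fin k → Fin n
      q j = proj₁ (hitQ j)

      UQ : Fin k → Fin n → Set
      UQ j = SinceHit (Edge E) X (X ∪ ⁅ y ⁆) (Q.U j) (Q.tgt j) (q j)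

      q∈ : ∀ j → q j ∈ X ∪ ⁅ y ⁆
      q∈ j = proj₁ (proj₂ (hitQ j))

      walkQ : ∀ j → Walk (Edge E) (UQ j) (q j) (Q.tgt j)
      walkQ j = proj₂ (proj₂ (hitQ j))

      p-injective : ∀ i i′ → p i ≡ p i′ → i ≡ i′
      p-injective i i′ eq = P.disjoint i i′ (proj₁ (lastʷ (walkP i)))
        (subst (P.U i′) (≡-sym eq) (proj₁ (lastʷ (walkP i′))))

      q-injective : ∀ j j′ → q j ≡ q j′ → j ≡ j′
      q-injective j j′ eq = Q.disjoint j j′ (proj₁ (headʷ (walkQ j)))
        (subst (Q.U j′) (≡-sym eq) (proj₁ (headʷ (walkQ j′))))

      -- `X` alone has fewer than `k` elements, so `v` must be a new one.
      ∉X : ∀ v → k ≤ ∣ X ∪ ⁅ v ⁆ ∣ → v ∉ X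
      ∉X v k≤ v∈X = ℕ.<⇒≱ ∣X∣<k (ℕ.≤-trans k≤ (p⊆q⇒∣p∣≤∣q∣ {p = X ∪ ⁅ v ⁆}
        ([ id , (λ { refl → v∈X }) ]′ ∘ y∈p∪⁅x⁆⁻ X)))

      y∉X : y ∉ X
      y∉X = ∉X y (injective⇒m≤∣p∣ _ q q∈ q-injective)

      q-covering : ∀ {v} → v ∈ X ∪ ⁅ y ⁆ → ∃[ j ] q j ≡ v
      q-covering = injective⇒covering _ q q∈ q-injective (ℕ.≤-trans (∣p∪⁅x⁆∣≤1+∣p∣ X y) ∣X∣<k)

      -- A first half ending in `X` continues from the same vertex, one ending at `x` crosses the
      -- new edge to `y`. The continuation exists because the `k` distinct starting points exhaust
      -- `X ∪ ⁅ y ⁆`.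
      mate : ∀ i → ∃[ j ] ((p i ∈ X × q j ≡ p i) ⊎ (p i ≡ x × q j ≡ y))
      mate i with y∈p∪⁅x⁆⁻ X (p∈ i)
      ... | inj₁ pi∈X = let j , eq = q-covering (⊆∪ pi∈X) in j , inj₁ (pi∈X , eq)
      ... | inj₂ pi≡x = let j , eq = q-covering (x∈p∪⁅x⁆ X y) in j , inj₂ (pi≡x , eq)

      mate-injective : ∀ i i′ → proj₁ (mate i) ≡ proj₁ (mate i′) → i ≡ i′
      mate-injective i i′ eq with mate i | mate i′
      mate-injective i i′ refl | j , inj₁ (_ , e) | _ , inj₁ (_ , e′) = p-injective i i′ (trans (≡-sym e) e′)
      mate-injective i i′ refl | j , inj₁ (h , e) | _ , inj₂ (_ , e′) =
        contradiction (subst (_∈ X) (trans (≡-sym e) e′) h) y∉X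
      mate-injective i i′ refl | j , inj₂ (_ , e) | _ , inj₁ (h , e′) =
        contradiction (subst (_∈ X) (trans (≡-sym e′) e) h) y∉X
      mate-injective i i′ refl | j , inj₂ (e , _) | _ , inj₂ (e′ , _) = p-injective i i′ (trans e (≡-sym e′))

      -- Outside `X`, a common vertex would splice the halves into a walk from `A` to `B` avoiding
      -- `X`. Inside `X`, it ends the one half and begins the other, so the two are mates.
      crossing : ∀ i i′ {z} → UP i z → UQ (proj₁ (mate i′)) z → i ≡ i′
      crossing i i′ {z} (_ , stopP , toz) (_ , stopQ , fromz) with z ∈? X
      ... | no z∉X = contradiction (toz z∉X ++ʷ fromz z∉X) (X-sep (P.src∈ i) (Q.tgt∈ _))
      ... | yes z∈X with stopP | stopQ
      ...   | inj₂ z∉ | _ = contradiction (⊆∪ z∈X) z∉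
      ...   | _ | inj₂ z∉ = contradiction (⊆∪ z∈X) z∉
      ...   | inj₁ z≡p | inj₁ z≡q with proj₂ (mate i′)
      ...     | inj₁ (_ , e) = p-injective i i′ (trans (≡-sym z≡p) (trans z≡q e))
      ...     | inj₂ (_ , e) = contradiction (subst (_∈ X) (trans z≡q e) z∈X) y∉X

      joined : ∀ i → Walk (Edge ((x , y) ∷ E)) (λ z → UP i z ⊎ UQ (proj₁ (mate i)) z)
        (P.src i) (Q.tgt (proj₁ (mate i)))
      joined i with mate i
      ... | j , inj₁ (_ , e) = mapʷ there inj₁ (walkP i) ++ʷ
              subst (λ v → Walk _ (λ z → UP i z ⊎ UQ j z) v (Q.tgt j)) e (mapʷ there inj₂ (walkQ j))
      ... | j , inj₂ (e , e′) = mapʷ there inj₁ (walkP i)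
              ++⟨ here (trans (cong (_, q j) e) (cong (x ,_) e′)) ⟩ mapʷ there inj₂ (walkQ j)

    join : Linkage (Edge ((x , y) ∷ E)) A B k
    join = record
      { U = λ i z → UP i z ⊎ UQ (proj₁ (mate i)) z
      ; disjoint = λ where
          i i′ (inj₁ u) (inj₁ u′) → P.disjoint i i′ (proj₁ u) (proj₁ u′)
          i i′ (inj₁ u) (inj₂ u′) → crossing i i′ u u′
          i i′ (inj₂ u) (inj₁ u′) → ≡-sym (crossing i′ i u′ u)
          i i′ (inj₂ u) (inj₂ u′) → mate-injective i i′ (Q.disjoint _ _ (proj₁ u) (proj₁ u′))
      ; src = P.src
      ; tgt = λ i → Q.tgt (proj₁ (mate i))
      ; src∈ = P.src∈
      ; tgt∈ = λ i → Q.tgt∈ _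
      ; walk = joined
      }

-- Göring's proof by induction on the (directed) edges: if deleting (x , y) leaves a separator X with
-- fewer than k vertices, then k disjoint walks from A to X ∪ {x} and k from X ∪ {y} to B can only
-- meet in X, and counting ends shows that they can be joined through X and the edge (x , y).
menger : (E : List (Fin n × Fin n)) (A B : Subset n) (k : ℕ) →
  (∃[ X ] (∣ X ∣ < k × Separates (Edge E) A B X)) ⊎ Linkage (Edge E) A B k
menger [] A B k with ℕ.<-≤-connex ∣ A ∩ B ∣ k
... | inj₁ small = inj₁ (A ∩ B , small , λ { a∈A a∈B [ a∉ ] → a∉ (x∈p∩q⁺ (a∈A , a∈B)) })
... | inj₂ large = let f , into , inj = choose k (A ∩ B) large in inj₂ record
  { U = λ i z → z ≡ f i
  ; disjoint = λ { i j refl e → inj i j e }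
  ; src = f
  ; tgt = f
  ; src∈ = λ i → proj₁ (x∈p∩q⁻ A B (into i))
  ; tgt∈ = λ i → proj₂ (x∈p∩q⁻ A B (into i))
  ; walk = λ i → [ refl ]
  }
menger ((x , y) ∷ E) A B k with menger E A B k
... | inj₂ L = inj₂ record { Linkage L ; walk = λ i → mapʷ there id (Linkage.walk L i) }
... | inj₁ (X , ∣X∣<k , X-sep) with menger E A (X ∪ ⁅ x ⁆) k | menger E (X ∪ ⁅ y ⁆) B k
...   | inj₁ (Z , ∣Z∣<k , Z-sep) | _ = inj₁ (Z , ∣Z∣<k , separates-front ∣X∣<k X-sep Z-sep)
...   | _ | inj₁ (Z , ∣Z∣<k , Z-sep) = inj₁ (Z , ∣Z∣<k , separates-back ∣X∣<k X-sep Z-sep)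
...   | inj₂ P | inj₂ Q = inj₂ (join ∣X∣<k X-sep P Q)

-- Growing trees

module _ {P : Fin n → Set} (P? : ∀ x → Dec (P x)) where

  select : Subset n
  select = Vec.tabulate (does ∘ P?)

  select⁺ : ∀ {x} → P x → x ∈ select
  select⁺ {x} p = lookup⇒[]= x select (trans (lookup∘tabulate _ x) (dec-true (P? x) p))

  select⁻ : ∀ {x} → x ∈ select → P x
  select⁻ {x} x∈ with P? x | trans (≡-sym (lookup∘tabulate (does ∘ P?) x)) ([]=⇒lookup x∈)
  ... | yes p | _ = p

module _ {G : Graph n} where

  walk⇒TConnected : (T : Subgraph G) →
    (∀ {u v} → u ∈ V T → v ∈ V T → Walk (AdjT T) (λ _ → Unit) u v) → TConnected T
  walk⇒TConnected T w u v u∈ v∈ = let xs , path , _ = toPath (w u∈ v∈) in xs , path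

  TConnected⇒walk : (T : Subgraph G) → TConnected T →
    ∀ {u v} → u ∈ V T → v ∈ V T → Walk (AdjT T) (λ _ → Unit) u v
  TConnected⇒walk T conn u∈ v∈ = fromPath (proj₂ (conn _ _ u∈ v∈)) (All.universal (λ _ → tt) _)

  point : Fin n → Subgraph G
  point x = record
    { V = ⁅ x ⁆
    ; E = λ _ → ⊥
    ; E⊆G = λ _ h → contradiction h ∉⊥
    ; Esym = λ h → contradiction h ∉⊥
    ; E⊆V = λ h → contradiction h ∉⊥
    }

  point-isTree : ∀ x → IsTree (point x)
  point-isTree x = walk⇒TConnected (point x) conn , λ (_ , _ , _ , _ , _ , _ , _ , _ , e) → contradiction e ∉⊥
    where
    conn : ∀ {u v} → u ∈ ⁅ x ⁆ → v ∈ ⁅ x ⁆ → Walk _ _ u v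
    conn u∈ v∈ with x∈⁅y⁆⇒x≡y x u∈ | x∈⁅y⁆⇒x≡y x v∈
    ... | refl | refl = [ tt ]

  module _ (T : Subgraph G) {u v : Fin n} (u∈V : u ∈ V T) (v∉V : v ∉ V T) (uv : v ∈ adj G u) where

    private
      NewEdge : Fin n → Fin n → Set
      NewEdge w z = z ∈ E T w ⊎ (w ≡ v × z ≡ u) ⊎ (w ≡ u × z ≡ v)

      newEdge? : ∀ w z → Dec (NewEdge w z)
      newEdge? w z = (z ∈? E T w) ⊎-dec ((w ≟ v) ×-dec (z ≟ u)) ⊎-dec ((w ≟ u) ×-dec (z ≟ v))

      newEdge-⊆G : ∀ {w z} → NewEdge w z → z ∈ adj G w
      newEdge-⊆G (inj₁ h) = E⊆G T _ h
      newEdge-⊆G (inj₂ (inj₁ (refl , refl))) = sym G uv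
      newEdge-⊆G (inj₂ (inj₂ (refl , refl))) = uv

      newEdge-sym : ∀ {w z} → NewEdge w z → NewEdge z w
      newEdge-sym (inj₁ h) = inj₁ (Esym T h)
      newEdge-sym (inj₂ (inj₁ (e , e′))) = inj₂ (inj₂ (e′ , e))
      newEdge-sym (inj₂ (inj₂ (e , e′))) = inj₂ (inj₁ (e′ , e))

      newEdge-⊆V : ∀ {w z} → NewEdge w z → w ∈ V T ∪ ⁅ v ⁆
      newEdge-⊆V (inj₁ h) = p⊆p∪q ⁅ v ⁆ (E⊆V T h)
      newEdge-⊆V (inj₂ (inj₁ (refl , _))) = x∈p∪⁅x⁆ (V T) v
      newEdge-⊆V (inj₂ (inj₂ (refl , _))) = p⊆p∪q ⁅ v ⁆ u∈V

      newEdge-at-leaf : ∀ {z} → NewEdge v z → z ≡ u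
      newEdge-at-leaf (inj₁ h) = contradiction (E⊆V T h) v∉V
      newEdge-at-leaf (inj₂ (inj₁ (_ , e))) = e
      newEdge-at-leaf (inj₂ (inj₂ (refl , _))) = contradiction u∈V v∉V

      newEdge-old : ∀ {w z} → w ≢ v → z ≢ v → NewEdge w z → z ∈ E T w
      newEdge-old _ _ (inj₁ h) = h
      newEdge-old w≢v _ (inj₂ (inj₁ (e , _))) = contradiction e w≢v
      newEdge-old _ z≢v (inj₂ (inj₂ (_ , e))) = contradiction e z≢v

    addLeaf : Subgraph G
    addLeaf = record
      { V = V T ∪ ⁅ v ⁆
      ; E = λ w → select (newEdge? w)
      ; E⊆G = λ w → newEdge-⊆G ∘ select⁻ (newEdge? w)
      ; Esym = λ {w} {z} → select⁺ (newEdge? z) ∘ newEdge-sym ∘ select⁻ (newEdge? w)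
      ; E⊆V = λ {w} → newEdge-⊆V ∘ select⁻ (newEdge? w)
      }

    -- A cycle through `v` would give `v` two distinct neighbours, but `u` is its only one; a cycle
    -- avoiding `v` already lies in `T`.
    addLeaf-isTree : IsTree T → IsTree addLeaf
    addLeaf-isTree (conn , acyclic) = walk⇒TConnected addLeaf conn′ , acyclic′
      where
      old : ∀ {a b} → a ∈ V T → b ∈ V T → Walk (AdjT addLeaf) (λ _ → Unit) a b
      old a∈ b∈ = mapʷ (select⁺ (newEdge? _) ∘ inj₁) id (TConnected⇒walk T conn a∈ b∈)
      conn′ : ∀ {a b} → a ∈ V T ∪ ⁅ v ⁆ → b ∈ V T ∪ ⁅ v ⁆ → Walk (AdjT addLeaf) (λ _ → Unit) a b
      conn′ a∈ b∈ with y∈p∪⁅x⁆⁻ (V T) a∈ | y∈p∪⁅x⁆⁻ (V T) b∈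
      ... | inj₁ a∈V | inj₁ b∈V = old a∈V b∈V
      ... | inj₁ a∈V | inj₂ refl = old a∈V u∈V ++⟨ select⁺ (newEdge? _) (inj₂ (inj₂ (refl , refl))) ⟩ [ tt ]
      ... | inj₂ refl | inj₁ b∈V = tt ∷⟨ select⁺ (newEdge? _) (inj₂ (inj₁ (refl , refl))) ⟩ old u∈V b∈V
      ... | inj₂ refl | inj₂ refl = [ tt ]
      linked-old : ∀ {xs} → All (_≢ v) xs → Linked (AdjT addLeaf) xs → Linked (AdjT T) xs
      linked-old _ [] = []
      linked-old _ [-] = [-]
      linked-old (p ∷ q ∷ ps) (r ∷ l) = newEdge-old p q (select⁻ (newEdge? _) r) ∷ linked-old (q ∷ ps) l
      acyclic′ : ¬ HasCycle addLeaf
      acyclic′ (xs , a , b , 3≤ , l , d , h , e , ba) with Any.any? (v ≟_) xs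
      ... | yes v∈xs = let p , q , p≢q , pv , vq = on-cycle xs 3≤ l d h e ba v∈xs in
        p≢q (trans (newEdge-at-leaf (newEdge-sym (select⁻ (newEdge? _) pv)))
                   (≡-sym (newEdge-at-leaf (select⁻ (newEdge? _) vq))))
      ... | no v∉xs = acyclic (xs , a , b , 3≤ , linked-old ≢v l , d , h , e ,
              newEdge-old (All.lookup ≢v (last-∈ xs e)) (All.lookup ≢v (head-∈ xs h)) (select⁻ (newEdge? _) ba))
        where
        ≢v : All (_≢ v) xs
        ≢v = All.map (_∘ ≡-sym) (¬Any⇒All¬ xs v∉xs)

    addLeaf-degree-new : ∣ E addLeaf v ∣ ≡ 1
    addLeaf-degree-new = trans (cong ∣_∣ (⊆-antisym
      (λ h → subst (_∈ ⁅ u ⁆) (≡-sym (newEdge-at-leaf (select⁻ (newEdge? v) h))) (x∈⁅x⁆ u))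
      (λ h → select⁺ (newEdge? v) (inj₂ (inj₁ (refl , x∈⁅y⁆⇒x≡y u h))))))
      (∣⁅x⁆∣≡1 u)

    addLeaf-degree-old : ∀ {w} → w ≢ u → w ≢ v → ∣ E addLeaf w ∣ ≡ ∣ E T w ∣
    addLeaf-degree-old {w} w≢u w≢v = cong ∣_∣ (⊆-antisym to (select⁺ (newEdge? w) ∘ inj₁))
      where
      to : E addLeaf w ⊆ E T w
      to h with select⁻ (newEdge? w) h
      ... | inj₁ h′ = h′
      ... | inj₂ (inj₁ (e , _)) = contradiction e w≢v
      ... | inj₂ (inj₂ (e , _)) = contradiction e w≢u

  module _ (S : Subset n) where

    LeavesIn : Subgraph G → Set
    LeavesIn T = ∀ s → s ∈ S → s ∈ V T → ∣ E T s ∣ ≡ 1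

    ClosedOutside : Subgraph G → Set
    ClosedOutside T = ∀ {u v} → u ∈ V T → u ∉ S → v ∈ adj G u → v ∈ V T

    GrownFrom : Fin n → Subgraph G → Set
    GrownFrom x T = IsTree T × x ∈ V T × LeavesIn T

    -- Growth proceeds only from vertices outside `S`, so terminals stay leaves. When it stops, the
    -- tree holds the whole component of `x` in `G` without `S`, and every terminal adjacent to it.
    maximalTree : ∀ {x} → x ∉ S → ∃[ T ] (GrownFrom x T × ClosedOutside T)
    -- At most `n` leaves can be added, so `n` is enough fuel; running out means that the tree
    -- contains every vertex.
    maximalTree {x} x∉S = go n (point x) (ℕ.m≤n+m n _)
      (point-isTree x , x∈⁅x⁆ x , λ s s∈S s∈V →
        contradiction (subst (_∈ S) (x∈⁅y⁆⇒x≡y x s∈V) s∈S) x∉S)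
      where
      Boundary? : ∀ T u v → Dec (u ∈ V T × u ∉ S × v ∉ V T × v ∈ adj G u)
      Boundary? T u v = (u ∈? V T) ×-dec ¬? (u ∈? S) ×-dec ¬? (v ∈? V T) ×-dec (v ∈? adj G u)
      go : ∀ f T → n ≤ ∣ V T ∣ + f → GrownFrom x T → ∃[ T ] (GrownFrom x T × ClosedOutside T)
      go f T bound grown with any? (λ u → any? (Boundary? T u))
      ... | no ¬h = T , grown , closed
        where
        closed : ClosedOutside T
        closed {u} {v} u∈ u∉S uv with v ∈? V T
        ... | yes v∈ = v∈
        ... | no v∉ = contradiction (u , v , u∈ , u∉S , v∉ , uv) ¬h
      go zero T bound grown | yes (u , v , _ , _ , v∉ , _) =
        contradiction (subst (v ∈_) (≡-sym full) ∈⊤) v∉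
        where
        full : V T ≡ ⊤
        full = ∣p∣≡n⇒p≡⊤ (ℕ.≤-antisym (∣p∣≤n (V T)) (ℕ.≤-trans bound (ℕ.≤-reflexive (ℕ.+-identityʳ _))))
      go (suc f) T bound (tree , x∈ , leaves) | yes (u , v , u∈ , u∉S , v∉ , uv) =
        go f (addLeaf T u∈ v∉ uv) bound′
          (addLeaf-isTree T u∈ v∉ uv tree , p⊆p∪q ⁅ v ⁆ x∈ , leaves′)
        where
        bound′ : n ≤ ∣ V T ∪ ⁅ v ⁆ ∣ + f
        bound′ = ℕ.≤-trans bound (ℕ.≤-reflexive (trans (ℕ.+-suc ∣ V T ∣ f)
          (cong (_+ f) (≡-sym (x∉p⇒∣p∪⁅x⁆∣≡1+∣p∣ v∉)))))
        leaves′ : LeavesIn (addLeaf T u∈ v∉ uv)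
        leaves′ s s∈S s∈ = [ (λ { refl → addLeaf-degree-new T u∈ v∉ uv }) , old ]′ (toSum (s ≟ v))
          where
          old : s ≢ v → ∣ E (addLeaf T u∈ v∉ uv) s ∣ ≡ 1
          old s≢v = trans
            (addLeaf-degree-old T u∈ v∉ uv (λ { refl → u∉S s∈S }) s≢v)
            (leaves s s∈S ([ id , (λ s≡v → contradiction s≡v s≢v) ]′ (y∈p∪⁅x⁆⁻ (V T) s∈)))

    pedant⇒HasTrees : (T : Subgraph G) → IsPedantSteinerTree S T → HasTrees G S 1
    pedant⇒HasTrees T pedant = (λ _ → T) , (λ _ → pedant) , λ { zero zero i≢i → contradiction refl i≢i }

    spanning⇒HasTrees : ∀ {x} (T : Subgraph G) → GrownFrom x T → S ⊆ V T → HasTrees G S 1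
    spanning⇒HasTrees T (tree , _ , leaves) S⊆V =
      pedant⇒HasTrees T (tree , S⊆V , λ s s∈S → leaves s s∈S (S⊆V s∈S))

    -- Paths in pedant Steiner trees

    module _ {T : Subgraph G} (pedant : IsPedantSteinerTree S T) where
      private
        conn = proj₁ (proj₁ pedant)
        S⊆V = proj₁ (proj₂ pedant)
        leaf = proj₂ (proj₂ pedant)

      -- An interior vertex has two distinct neighbours on the path, but a terminal has only one in
      -- the tree.
      terminal-is-end : ∀ {u v xs z} → IsPath (AdjT T) u v xs → z LM.∈ xs → z ∈ S → z ≡ u ⊎ z ≡ v
      terminal-is-end {xs = xs} (l , d , h , e) z∈xs z∈S with end-or-interior xs l d z∈xs
      ... | inj₁ h′ = inj₁ (just-injective (trans (≡-sym h′) h))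
      ... | inj₂ (inj₁ e′) = inj₂ (just-injective (trans (≡-sym e′) e))
      ... | inj₂ (inj₂ (a , b , a≢b , az , zb)) =
        contradiction (∣p∣≡1⇒≡ (leaf _ z∈S) (Esym T az) zb) a≢b

      -- There is a third terminal `t`. The tree path from `s` to `t` must start with the only edge
      -- at `s`, so `w` would be interior to it, which no terminal is.
      terminals-nonadjacent : 3 ≤ ∣ S ∣ → ∀ {s w} → s ∈ S → w ∈ E T s → w ∉ S
      terminals-nonadjacent 3≤∣S∣ {s} {w} s∈S sw w∈S
        with ∃∈∖ S (⁅ s ⁆ ∪ ⁅ w ⁆) (ℕ.≤-<-trans (ℕ.≤-trans (∣p∪⁅x⁆∣≤1+∣p∣ ⁅ s ⁆ w)
          (s≤s (ℕ.≤-reflexive (∣⁅x⁆∣≡1 s)))) 3≤∣S∣)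
      ... | t , t∈S , t∉ with conn s t (S⊆V s∈S) (S⊆V t∈S)
      ...   | (_ ∷ []) , (_ , _ , refl , refl) = t∉ (p⊆p∪q ⁅ w ⁆ (x∈⁅x⁆ s))
      ...   | (_ ∷ y ∷ ys) , path@(r ∷ _ , _ , refl , _)
              with ∣p∣≡1⇒≡ (leaf s s∈S) sw r
      ...     | refl with terminal-is-end path (there (here refl)) w∈S
      ...       | inj₁ refl = irrefl G (E⊆G T s sw)
      ...       | inj₂ refl = t∉ (x∈p∪⁅x⁆ ⁅ s ⁆ w)

      -- Terminals occur on tree paths only as ends, so deleting `X` does not touch a path whose
      -- ends survive.
      path-avoiding : ∀ {X u v} → X ⊆ S → u ∈ V T → v ∈ V T → u ∉ X → v ∉ X →
        ∃[ xs ] IsPath (AdjMinus G X) u v xs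
      path-avoiding {X} X⊆S u∈ v∈ u∉X v∉X with conn _ _ u∈ v∈
      ... | xs , path = let ys , path′ , _ = toPath (mapʷ (λ (a∉ , b∉ , ab) → a∉ , b∉ , E⊆G T _ ab) id
                              (annotateEdges (fromPath path (All.tabulate avoid)))) in ys , path′
        where
        avoid : ∀ {z} → z LM.∈ xs → z ∉ X
        avoid z∈xs z∈X with terminal-is-end path z∈xs (X⊆S z∈X)
        ... | inj₁ refl = u∉X z∈X
        ... | inj₂ refl = v∉X z∈X

-- Fans and trees

invariantʷ : {R : Fin n → Fin n → Set} {U Q : Fin n → Set} → (∀ {a b} → R a b → Q b) →
  ∀ {a b} → Q a → Walk R U a b → Walk R (λ z → U z × Q z) a b
invariantʷ f q [ u ] = [ u , q ]
invariantʷ f q (u ∷⟨ r ⟩ w) = (u , q) ∷⟨ r ⟩ invariantʷ f (f r) w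

module _ (G : Graph n) where

  -- The edges of `G` without `x`, each in both directions. Linking the neighbours of `x` to `S` in
  -- this graph and then prefixing `x` gives a fan.
  edgesAvoiding : Fin n → List (Fin n × Fin n)
  edgesAvoiding x = filter edge? (cartesianProduct (allFin n) (allFin n))
    where
    edge? : ∀ e → Dec (proj₁ e ≢ x × proj₂ e ≢ x × proj₂ e ∈ adj G (proj₁ e))
    edge? (u , v) = ¬? (u ≟ x) ×-dec ¬? (v ≟ x) ×-dec (v ∈? adj G u)

  edgesAvoiding⁺ : ∀ {x u v} → u ≢ x → v ≢ x → v ∈ adj G u → Edge (edgesAvoiding x) u v
  edgesAvoiding⁺ {u = u} {v} u≢x v≢x uv =
    ∈-filter⁺ _ (∈-cartesianProduct⁺ (∈-allFin u) (∈-allFin v)) (u≢x , v≢x , uv)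

  edgesAvoiding⁻ : ∀ {x u v} → Edge (edgesAvoiding x) u v → u ≢ x × v ≢ x × v ∈ adj G u
  edgesAvoiding⁻ e = proj₂ (∈-filter⁻ _ {xs = cartesianProduct (allFin n) (allFin n)} e)

  -- A separator `X` of fewer than `k` vertices misses some `s` in `S`. A path from `x` to `s`
  -- continues from a neighbour of `x` without returning to `x`, so `X` would cut `x` off from `s`
  -- in `G`.
  fan-linkage : ∀ {x S} k → x ∉ S → k ≤ ∣ S ∣ → (∀ X → Separating G X → k ≤ ∣ X ∣) →
    Linkage (Edge (edgesAvoiding x)) (adj G x) S k
  fan-linkage {x} {S} k x∉S k≤∣S∣ conn with menger (edgesAvoiding x) (adj G x) S k
  ... | inj₂ L = L
  ... | inj₁ (X , ∣X∣<k , X-sep) with ∃∈∖ S X (ℕ.<-≤-trans ∣X∣<k k≤∣S∣)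
  ...   | s , s∈S , s∉X = contradiction ∣X∣<k (ℕ.≤⇒≯ (ℕ.≤-trans
            -- The separator from Menger's theorem may contain `x`, which is here one of the two
            -- vertices to be separated.
            (conn (X - x) (inj₁ (x , s , x∉p-x X x , s∉X ∘ p-x⊆p X x , λ (xs , path) → unreachable xs path)))
            (p⊆q⇒∣p∣≤∣q∣ (p-x⊆p X x))))
    where
    unreachable : ∀ xs → ¬ IsPath (AdjMinus G (X - x)) x s xs
    unreachable (_ ∷ []) (_ , _ , refl , refl) = x∉S s∈S
    unreachable (_ ∷ y ∷ ys) ((_ , y∉ , xy) ∷ l , x# ∷ _ , refl , e) = X-sep xy s∈S
      (mapʷ (λ ((a≢ , _) , (b≢ , _) , _ , _ , ab) → edgesAvoiding⁺ (a≢ ∘ ≡-sym) (b≢ ∘ ≡-sym) ab)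
        (λ (z≢ , z∉) z∈X → z∉ (x∈p∧x≢y⇒x∈p-y z∈X (z≢ ∘ ≡-sym)))
        (annotateEdges (invariantʷ (proj₁ ∘ proj₂) y∉ (fromLinked ys l e x#))))

  module _ {x : Fin n} {S : Subset n} {m : ℕ} (x∉S : x ∉ S) (∣S∣ : ∣ S ∣ ≡ suc m)
           (L : Linkage (Edge (edgesAvoiding x)) (adj G x) S m) where
    open Linkage L
    private
      hit : ∀ i → _
      hit i = untilHit {X = S} id (walk i) (tgt∈ i)

      tip : Fin m → Fin n
      tip i = proj₁ (hit i)

      tip∈S : ∀ i → tip i ∈ S
      tip∈S i = proj₁ (proj₂ (hit i))

      Leg : Fin m → Fin n → Set
      Leg i z = U i z × (z ≡ tip i ⊎ z ∉ S) × z ≢ x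

      src≢x : ∀ i → src i ≢ x
      src≢x i e = irrefl G (subst (_∈ adj G x) e (src∈ i))

      leg : ∀ i → ∃[ xs ] (IsPath (Adj G) (src i) (tip i) xs × All (Leg i) xs)
      leg i = toPath (mapʷ (proj₂ ∘ proj₂ ∘ edgesAvoiding⁻) (λ ((u , h , _) , z≢x) → u , h , z≢x)
        (invariantʷ (proj₁ ∘ proj₂ ∘ edgesAvoiding⁻) (src≢x i) (proj₂ (proj₂ (hit i)))))

      P : Fin m → List (Fin n)
      P i = x ∷ proj₁ (leg i)

      onLeg : ∀ i {z} → z LM.∈ proj₁ (leg i) → Leg i z
      onLeg i = All.lookup (proj₂ (proj₂ (leg i)))

      missed : ∃[ u ] (u ∈ S × ¬ (∃[ i ] tip i ≡ u))
      missed with any? (λ u → (u ∈? S) ×-dec ¬? (any? (λ i → tip i ≟ u)))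
      ... | yes h = h
      ... | no ¬h = contradiction (covering⇒∣p∣≤m S tip cov) (ℕ.<⇒≱ (ℕ.≤-reflexive (≡-sym ∣S∣)))
        where
        cov : ∀ {u} → u ∈ S → ∃[ i ] tip i ≡ u
        cov {u} u∈S with any? (λ i → tip i ≟ u)
        ... | yes h = h
        ... | no ¬h′ = contradiction (u , u∈S , ¬h′) ¬h

      u₁ : Fin n
      u₁ = proj₁ missed

      tip≢u₁ : ∀ i → tip i ≢ u₁
      tip≢u₁ i e = proj₂ (proj₂ missed) (i , e)

      path : ∀ i → IsPath (Adj G) x (tip i) (P i)
      path i with leg i
      ... | (y ∷ ys) , (l , d , refl , e) , legs =
        src∈ i ∷ l , All.map (λ (_ , _ , z≢x) → z≢x ∘ ≡-sym) legs ∷ d , refl , e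

      fan : IsFan G x (S - u₁) m P
      fan = (λ i → tip i , x∈p∧x≢y⇒x∈p-y (tip∈S i) (tip≢u₁ i) , path i , last-only i) , apart
        where
        last-only : ∀ i z → z LM.∈ P i → z ∈ S - u₁ → z ≡ tip i
        last-only i z (here refl) z∈ = contradiction (p-x⊆p S u₁ z∈) x∉S
        last-only i z (there z∈P) z∈ with onLeg i z∈P
        ... | _ , inj₁ z≡tip , _ = z≡tip
        ... | _ , inj₂ z∉S , _ = contradiction (p-x⊆p S u₁ z∈) z∉S
        apart : ∀ i j → i ≢ j → ∀ z → z LM.∈ P i → z LM.∈ P j → z ≡ x
        apart i j i≢j z (here z≡x) _ = z≡x
        apart i j i≢j z (there _) (here z≡x) = z≡x
        apart i j i≢j z (there z∈) (there z∈′) =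
          contradiction (disjoint i j (proj₁ (onLeg i z∈)) (proj₁ (onLeg j z∈′))) i≢j

      u₁-avoided : ∀ i → ¬ u₁ LM.∈ P i
      u₁-avoided i (here u₁≡x) = x∉S (subst (_∈ S) u₁≡x (proj₁ (proj₂ missed)))
      u₁-avoided i (there u₁∈) with onLeg i u₁∈
      ... | _ , inj₁ e , _ = tip≢u₁ i (≡-sym e)
      ... | _ , inj₂ u₁∉S , _ = u₁∉S (proj₁ (proj₂ missed))

    -- Each walk is cut at its first vertex in `S`. The `m` tips leave over one of the `m + 1`
    -- terminals, and since a leg meets `S` only in its tip, this terminal lies on no path of the
    -- fan.
    fan-missing-one : ∃[ u ] (u ∈ S × ∃[ P ] (IsFan G x (S - u) m P × (∀ i → ¬ u LM.∈ P i)))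
    fan-missing-one = u₁ , proj₁ (proj₂ missed) , P , fan , u₁-avoided

  -- Terminal sets with and without a tree

  fanCondition⇒noTree : ∀ m → 2 ≤ m → (∀ X → Separating G X → m ≤ ∣ X ∣) →
    FanCondition G (suc m) → ∃[ S ] (∣ S ∣ ≡ suc m × ¬ HasTrees G S 1)
  fanCondition⇒noTree m 2≤m conn (S , ∣S∣ , cond) = S , ∣S∣ , refute
    where
    refute : ¬ HasTrees G S 1
    -- `x` is the tree neighbour of a terminal, hence not a terminal. The tree joins the missed `u₁`
    -- to `x` without meeting `S - u₁`, so the condition would put `u₁` on a fan that avoids it.
    refute (F , pedant , _) =
      let T = F zero
          S⊆V = proj₁ (proj₂ (pedant zero))
          s , s∈S = ∣p∣>0⇒∃∈ S (ℕ.≤-trans (s≤s z≤n) (ℕ.≤-reflexive (≡-sym ∣S∣)))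
          x , sx = ∣p∣>0⇒∃∈ (E T s) (ℕ.≤-reflexive (≡-sym (proj₂ (proj₂ (pedant zero)) s s∈S)))
          x∉S = terminals-nonadjacent S {T} (pedant zero)
            (ℕ.≤-trans (s≤s 2≤m) (ℕ.≤-reflexive (≡-sym ∣S∣))) s∈S sx
          u₁ , u₁∈S , P , fan , avoided = fan-missing-one x∉S ∣S∣
            (fan-linkage m x∉S (ℕ.≤-trans (ℕ.n≤1+n m) (ℕ.≤-reflexive (≡-sym ∣S∣))) conn)
          i , u₁∈P , _ = cond (S - u₁) (p-x⊆p S u₁)
            (ℕ.suc-injective (trans (x∈p⇒1+∣p-x∣≡∣p∣ u₁∈S) ∣S∣)) u₁ u₁∈S (x∉p-x S u₁)
            x (path-avoiding S {T} (pedant zero) (p-x⊆p S u₁) (S⊆V u₁∈S) (E⊆V T (Esym T sx))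
                (x∉p-x S u₁) (x∉S ∘ p-x⊆p S u₁)) x∉S P fan
      in avoided i u₁∈P

  -- `S` is chosen to contain `X` and two vertices that `X` separates; the tree path between these
  -- would avoid `X`. The other kind of separator leaves at most one vertex and is too large.
  lowConnectivity⇒noTree : ∀ {X k} → Separating G X → 2 + ∣ X ∣ ≤ k → k ≤ n →
    ∃[ S ] (∣ S ∣ ≡ k × ¬ HasTrees G S 1)
  lowConnectivity⇒noTree {X} {k} (inj₂ ∣∁X∣≤1) ∣X∣+2≤k k≤n = contradiction
    (ℕ.≤-trans (ℕ.m≤n+m∸n n ∣ X ∣) (ℕ.+-monoʳ-≤ ∣ X ∣ (ℕ.≤-trans (ℕ.≤-reflexive (≡-sym (∣∁p∣≡n∸∣p∣ X))) ∣∁X∣≤1)))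
    (ℕ.<⇒≱ (ℕ.≤-trans (ℕ.≤-reflexive (cong suc (ℕ.+-comm ∣ X ∣ 1))) (ℕ.≤-trans ∣X∣+2≤k k≤n)))
  lowConnectivity⇒noTree {X} {k} (inj₁ (u , v , u∉X , v∉X , unreachable)) ∣X∣+2≤k k≤n
    with ∃⊇-of-size k ((X ∪ ⁅ u ⁆) ∪ ⁅ v ⁆)
      (ℕ.≤-trans (ℕ.≤-trans (∣p∪⁅x⁆∣≤1+∣p∣ (X ∪ ⁅ u ⁆) v) (s≤s (∣p∪⁅x⁆∣≤1+∣p∣ X u))) ∣X∣+2≤k) k≤n
  ... | S , incl , ∣S∣ = S , ∣S∣ , λ (F , pedant , _) →
    let S⊆V = proj₁ (proj₂ (pedant zero)) in
    unreachable (path-avoiding S {F zero} (pedant zero) (incl ∘ p⊆p∪q ⁅ v ⁆ ∘ p⊆p∪q ⁅ u ⁆)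
      (S⊆V (incl (p⊆p∪q ⁅ v ⁆ (x∈p∪⁅x⁆ X u)))) (S⊆V (incl (x∈p∪⁅x⁆ (X ∪ ⁅ u ⁆) v))) u∉X v∉X)

  -- The tree edge at `v` would lead to a neighbour of `v`, and all of these are terminals.
  closedNeighbourhood⇒noTree : ∀ v → 2 ≤ degree G v →
    ∃[ S ] (∣ S ∣ ≡ suc (degree G v) × ¬ HasTrees G S 1)
  closedNeighbourhood⇒noTree v 2≤deg = S , ∣S∣ , λ (F , pedant , _) →
    let w , vw = ∣p∣>0⇒∃∈ (E (F zero) v)
          (ℕ.≤-reflexive (≡-sym (proj₂ (proj₂ (pedant zero)) v (x∈p∪⁅x⁆ _ v))))
    in terminals-nonadjacent S {F zero} (pedant zero) (ℕ.≤-trans (s≤s 2≤deg) (ℕ.≤-reflexive (≡-sym ∣S∣)))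
         (x∈p∪⁅x⁆ _ v) vw (p⊆p∪q ⁅ v ⁆ (E⊆G (F zero) v vw))
    where
    S = adj G v ∪ ⁅ v ⁆
    ∣S∣ = x∉p⇒∣p∪⁅x⁆∣≡1+∣p∣ {p = adj G v} (irrefl G)

  -- If a maximal tree from `x` missed a terminal `s`, then `S ∩ V T` would separate `x` from `s`,
  -- as edges leave `V T` only at terminals; but this set is smaller than `S`.
  highConnectivity⇒HasTrees : ∀ S → (∀ X → Separating G X → ∣ S ∣ ≤ ∣ X ∣) → ∣ S ∣ < n → HasTrees G S 1
  highConnectivity⇒HasTrees S conn ∣S∣<n with ∃∉ S ∣S∣<n
  ... | x , x∉S with maximalTree S {x} x∉S
  ...   | T , grown , closed = spanning⇒HasTrees S T grown S⊆V
    where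
    S⊆V : S ⊆ V T
    S⊆V {s} s∈S with s ∈? V T
    ... | yes s∈V = s∈V
    ... | no s∉V = contradiction (conn (S ∩ V T) (inj₁ (x , s , x∉S ∘ proj₁ ∘ x∈p∩q⁻ S (V T) ,
            s∉V ∘ proj₂ ∘ x∈p∩q⁻ S (V T) , λ (xs , path) →
              confined (proj₁ (proj₂ grown)) x∉S (fromPath path (All.universal (λ _ → tt) xs)))))
          (ℕ.<⇒≱ (p⊂q⇒∣p∣<∣q∣ (p∩q⊆p S (V T) , s , s∈S , s∉V ∘ proj₂ ∘ x∈p∩q⁻ S (V T))))
      where
      confined : ∀ {a} → a ∈ V T → a ∉ S → ¬ Walk (AdjMinus G (S ∩ V T)) (λ _ → Unit) a s
      confined a∈V a∉S [ _ ] = a∉S s∈S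
      confined a∈V a∉S (_ ∷⟨ _ , b∉ , ab ⟩ w) =
        let b∈V = closed a∈V a∉S ab in confined b∈V (λ b∈S → b∉ (x∈p∩q⁺ (b∈S , b∈V))) w

  -- A maximal tree from `x` absorbs each leg, whose vertices before the tip are no terminals, and
  -- likewise the path to `u₁`. The `m` distinct tips are all of `S'`.
  fan⇒HasTrees : ∀ {S S' x u₁ m P} → ∣ S ∣ ≡ suc m → S' ⊆ S → ∣ S' ∣ ≡ m → u₁ ∈ S → u₁ ∉ S' → x ∉ S →
    ∃[ ys ] IsPath (AdjMinus G S') u₁ x ys → IsFan G x S' m P → (∀ i → ¬ u₁ LM.∈ P i) → HasTrees G S 1
  fan⇒HasTrees {S} {S'} {x} {u₁} {m} {P} ∣S∣ S'⊆S ∣S'∣ u₁∈S u₁∉S' x∉S (ys , u₁x) (legs , apart) avoids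
    with maximalTree S {x} x∉S
  ... | T , grown@(_ , x∈V , _) , closed = spanning⇒HasTrees S T grown S⊆V
    where
    -- `S` consists of `S'` and `u₁` alone: a further `z` would put `∣ S - z ∣` strictly between
    -- `∣ S' ∣` and `∣ S' ∣ + 1`.
    outside-S : ∀ {z} → z ≢ u₁ → z ∉ S' → z ∉ S
    outside-S {z} z≢u₁ z∉S' z∈S = ℕ.<-irrefl (trans (cong suc ∣S'∣) (≡-sym ∣S∣))
      (ℕ.<-≤-trans (s≤s (p⊂q⇒∣p∣<∣q∣ (S'⊆S-z , u₁ , x∈p∧x≢y⇒x∈p-y u₁∈S (z≢u₁ ∘ ≡-sym) , u₁∉S')))
        (x∈p⇒∣p-x∣<∣p∣ z∈S))
      where
      S'⊆S-z : S' ⊆ S - z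
      S'⊆S-z y∈ = x∈p∧x≢y⇒x∈p-y (S'⊆S y∈) (λ { refl → z∉S' y∈ })

    tip : Fin m → Fin n
    tip i = proj₁ (legs i)

    tip-injective : ∀ i j → tip i ≡ tip j → i ≡ j
    tip-injective i j eq with i ≟ j
    ... | yes i≡j = i≡j
    -- Distinct paths of the fan share only `x`, so a common tip would be `x`, which is not in `S`.
    ... | no i≢j =
      let _ , t∈S' , (_ , _ , _ , e) , _ = legs i
          _ , _ , (_ , _ , _ , e′) , _ = legs j
      in contradiction (S'⊆S (subst (_∈ S')
           (apart i j i≢j (tip i) (last-∈ (P i) e) (subst (LM._∈ P j) (≡-sym eq) (last-∈ (P j) e′))) t∈S')) x∉S

    along : ∀ {a y} → a ∈ V T → Walk (Adj G) (λ z → z ≢ u₁ × (z ∈ S' → z ≡ y)) a y → y ∈ V T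
    along a∈V [ _ ] = a∈V
    along {a} a∈V ((a≢u₁ , only) ∷⟨ ab ⟩ w) with a ∈? S'
    ... | yes a∈S' = subst (_∈ V T) (only a∈S') a∈V
    ... | no a∉S' = along (closed a∈V (outside-S a≢u₁ a∉S') ab) w

    S'⊆V : S' ⊆ V T
    S'⊆V s∈S' with injective⇒covering S' tip (λ i → proj₁ (proj₂ (legs i))) tip-injective (ℕ.≤-reflexive ∣S'∣) s∈S'
    ... | i , refl = let _ , _ , path , only = legs i in
      along x∈V (fromPath path (All.tabulate λ {z} z∈ → (λ { refl → avoids i z∈ }) , only z z∈))

    -- The path is given towards `x` but the tree grows from `x`, so the rest of the path is
    -- absorbed before its first vertex.
    backwards : ∀ {a} → Walk (AdjMinus G S') (_≢ u₁) a x → a ∈ V T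
    backwards [ _ ] = x∈V
    backwards (_ ∷⟨ _ , b∉S' , ab ⟩ w) = closed (backwards w) (outside-S (headʷ w) b∉S') (sym G ab)

    u₁∈V : ∀ ys → IsPath (AdjMinus G S') u₁ x ys → u₁ ∈ V T
    u₁∈V (_ ∷ []) (_ , _ , refl , refl) = x∈V
    u₁∈V (_ ∷ y ∷ ys) ((_ , y∉S' , u₁y) ∷ l , u₁# ∷ _ , refl , e) =
      let w = fromLinked ys l e (All.map (_∘ ≡-sym) u₁#)
      in closed (backwards w) (outside-S (headʷ w) y∉S') (sym G u₁y)

    S⊆V : S ⊆ V T
    S⊆V {s} s∈S with s ∈? S' | s ≟ u₁
    ... | yes s∈S' | _ = S'⊆V s∈S'
    ... | no _ | yes refl = u₁∈V ys u₁x
    ... | no s∉S' | no s≢u₁ = contradiction s∈S (outside-S s≢u₁ s∉S')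

  -- The same `S` serves. A fan avoiding `u₁` would yield a tree; and where `u₁` lies on a path it
  -- is internal, the ends being `x` outside `S` and a vertex of `S'`.
  noTree⇒fanCondition : ∀ {m} → ∃[ S ] (∣ S ∣ ≡ suc m × ¬ HasTrees G S 1) → FanCondition G (suc m)
  noTree⇒fanCondition {m} (S , ∣S∣ , ¬tree) = S , ∣S∣ , internal
    where
    internal : ∀ S' → S' ⊆ S → ∣ S' ∣ ≡ m → ∀ u₁ → u₁ ∈ S → u₁ ∉ S' →
      ∀ x → ∃[ ys ] IsPath (AdjMinus G S') u₁ x ys → x ∉ S →
      ∀ (P : Fin m → List (Fin n)) → IsFan G x S' m P → ∃[ i ] Internal u₁ (P i)
    internal S' S'⊆S ∣S'∣ u₁ u₁∈S u₁∉S' x u₁x x∉S P fan with any? (λ i → Any.any? (u₁ ≟_) (P i))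
    ... | no avoids = contradiction
      (fan⇒HasTrees {P = P} ∣S∣ S'⊆S ∣S'∣ u₁∈S u₁∉S' x∉S u₁x fan (λ i u₁∈ → avoids (i , u₁∈))) ¬tree
    ... | yes (i , u₁∈) =
      let _ , y∈S' , (_ , _ , h , e) , _ = proj₁ fan i
      in i , u₁∈ , (λ h′ → x∉S (subst (_∈ S) (just-injective (trans (≡-sym h′) h)) u₁∈S))
                 , (λ e′ → u₁∉S' (subst (_∈ S') (just-injective (trans (≡-sym e) e′)) y∈S'))

  -- Bounds on the connectivity, and the equivalence

  ∣p∣≤1 : (p : Subset n) (v : Fin n) → (∀ {w} → w ∈ p → w ≡ v) → ∣ p ∣ ≤ 1
  ∣p∣≤1 p v unique = covering⇒∣p∣≤m p (λ (_ : Fin 1) → v) (λ w∈p → zero , ≡-sym (unique w∈p))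

  -- This yields κ ≤ δ. Either a vertex other than `v` lies outside the neighbourhood and is cut off
  -- from `v`, or only `v` remains.
  neighbourhood-separating : ∀ v → Separating G (adj G v)
  neighbourhood-separating v with any? (λ w → ¬? (w ∈? adj G v) ×-dec ¬? (w ≟ v))
  ... | yes (w , w∉ , w≢v) = inj₁ (v , w , irrefl G , w∉ , λ where
          (_ ∷ [] , _ , _ , refl , refl) → w≢v refl
          (_ ∷ _ ∷ _ , (_ , y∉ , vy) ∷ _ , _ , refl , _) → y∉ vy)
  ... | no ¬h = inj₂ (∣p∣≤1 _ v only)
    where
    only : ∀ {w} → w ∈ ∁ (adj G v) → w ≡ v
    only {w} w∈ with w ≟ v
    ... | yes e = e
    ... | no w≢v = contradiction (w , x∈∁p⇒x∉p w∈ , w≢v) ¬h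

  -- Leaving a single vertex counts as separating, so κ ≤ n - 1. For κ ≥ k this provides a vertex
  -- outside `S`.
  connectivity<order : ∀ {c} → (∀ X → Separating G X → c ≤ ∣ X ∣) → Fin n → c < n
  connectivity<order {c} conn v = ℕ.≤-<-trans (conn (⊤ - v) (inj₂ (∣p∣≤1 _ v only)))
    (ℕ.<-≤-trans (x∈p⇒∣p-x∣<∣p∣ (∈⊤ {x = v})) (ℕ.≤-reflexive (∣⊤∣≡n n)))
    where
    only : ∀ {w} → w ∈ ∁ (⊤ - v) → w ≡ v
    only {w} w∈ with w ≟ v
    ... | yes e = e
    ... | no w≢v = contradiction (x∈p∧x≢y⇒x∈p-y ∈⊤ w≢v) (x∈∁p⇒x∉p w∈)

  -- The empty family serves every set, so one set without a tree brings the minimum down to 0.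
  noTree⇒tau≡0 : ∀ {k} → ∃[ S ] (∣ S ∣ ≡ k × ¬ HasTrees G S 1) → IsTauK G k 0
  noTree⇒tau≡0 (S , ∣S∣ , ¬tree) = (S , ∣S∣ , none , ¬tree) , λ _ _ → none
    where
    none : ∀ {S} → HasTrees G S 0
    none = (λ ()) , (λ ()) , λ ()

theorem7 : (k n : ℕ) → 3 ≤ k → k ≤ n → (G : Graph n) → Connected G →
    (c d : ℕ) → IsConnectivity G c → IsMinDegree G d →
    (IsTauK G k 0 ⇔
    (c ≤ k ∸ 2
    ⊎ (c ≡ k ∸ 1 × d ≡ k ∸ 1)
    ⊎ (c ≡ k ∸ 1 × k ≤ d × FanCondition G k)))
theorem7 (suc (suc (suc k))) n (s≤s (s≤s (s≤s z≤n))) k≤n G _ c d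
  ((X , ∣X∣≡c , X-sep) , conn) ((v , deg≡d) , _) = mk⇔ to from
  where
  to : IsTauK G (3 + k) 0 → _
  -- After matching, the given order of `S` is `3 + k`, so the critical value for both `c` and `d`
  -- is `2 + k`.
  to ((S , ∣S∣ , _ , ¬tree) , _) with ℕ.<-cmp c (2 + k)
  ... | tri< (s≤s c≤) _ _ = inj₁ c≤
  ... | tri> _ _ c> = contradiction (highConnectivity⇒HasTrees G S
          (λ Y Y-sep → ℕ.≤-trans ∣S∣≤c (conn Y Y-sep))
          (ℕ.≤-<-trans ∣S∣≤c (connectivity<order G conn v))) ¬tree
    where
    ∣S∣≤c : ∣ S ∣ ≤ c
    ∣S∣≤c = ℕ.≤-trans (ℕ.≤-reflexive ∣S∣) c>
  ... | tri≈ _ c≡ _ with ℕ.<-cmp d (2 + k)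
  -- Excluded by κ ≤ δ.
  ...   | tri< d< _ _ = contradiction
            (ℕ.≤-trans (ℕ.≤-reflexive (≡-sym c≡)) (ℕ.≤-trans (conn _ (neighbourhood-separating G v)) (ℕ.≤-reflexive deg≡d)))
            (ℕ.<⇒≱ d<)
  ...   | tri≈ _ d≡ _ = inj₂ (inj₁ (c≡ , d≡))
  ...   | tri> _ _ k≤d = inj₂ (inj₂ (c≡ , k≤d , noTree⇒fanCondition G (S , ∣S∣ , ¬tree)))

  from : _ → IsTauK G (3 + k) 0
  from (inj₁ c≤) = noTree⇒tau≡0 G (lowConnectivity⇒noTree G X-sep
    (s≤s (s≤s (ℕ.≤-trans (ℕ.≤-reflexive ∣X∣≡c) c≤))) k≤n)
  from (inj₂ (inj₁ (_ , d≡))) = noTree⇒tau≡0 G (subst (λ m → ∃[ S ] (∣ S ∣ ≡ suc m × ¬ HasTrees G S 1))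
    (trans deg≡d d≡) (closedNeighbourhood⇒noTree G v
      (ℕ.≤-trans (s≤s (s≤s z≤n)) (ℕ.≤-reflexive (≡-sym (trans deg≡d d≡))))))
  from (inj₂ (inj₂ (c≡ , _ , fan))) = noTree⇒tau≡0 G (fanCondition⇒noTree G (2 + k) (s≤s (s≤s z≤n))
    (λ Y Y-sep → ℕ.≤-trans (ℕ.≤-reflexive (≡-sym c≡)) (conn Y Y-sep)) fan)
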